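{- Let $d,n>1$ and $k,r\ge 1$ be integers and let $H$ be a finite abelian group such that $\exp(H)\mid d^k$, $\gcd(d,n)\le d-1$ and $d^kn\ge 6$. Let $G=H\oplus C_{d^kn}^r$ and let $A=\{1,2,\ldots,d^kn-1\}\setminus\{d^kn/d^j : j\in[1,k]\}$. Then $G$ is $0$-complete with respect to $A$; that is, for every sequence $S$ over $G$, $$N_{A,0}(S)\ \ge\ 2^{|S|-D_A(G)+1}.$$
   Context: $C_m$ is the cyclic group of order $m$ (written additively), $C_m^r$ is the direct sum of $r$ copies of it, $\exp$ denotes the exponent of a group, and $[a,b]=\{x\in\mathbb{N}_0: a\le x\le b\}$. A sequence $S=g_1\cdots g_m$ over $G$ is a finite unordered list of elements of $G$ with repetition allowed (an element of the free abelian monoid on $G$), of length $|S|=m$; the empty sequence is allowed. Subsequences of $S$ correspond to index sets $I\subseteq[1,m]$, and subsequences with different index sets are considered different. For a nonempty set $A$ of integers, $D_A(G)$ (the $A$-weighted Davenport constant) is the smallest positive integer $t$ such that for every sequence $g_1\cdots g_t$ over $G$ of length $t$ there are a nonempty $I\subseteq[1,t]$ and $a_i\in A$ ($i\in I$) with $\sum_{i\in I}a_ig_i=0$. For $S=g_1\cdots g_m$ and $g\in G$, $N_{A,g}(S)$ is the number of subsets $I\subseteq[1,m]$ for which there exist $a_i\in A$ ($i\in I$) with $\sum_{i\in I}a_ig_i=g$. The empty set is allowed, with empty sum equal to $0$, so it is counted in $N_{A,0}(S)$. -}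

module Defs where

open import Algebra.Bundles using (AbelianGroup; Group)
import Algebra.Construct.DirectProduct as DirectProduct
import Algebra.Construct.Pointwise as Pointwise
import Algebra.Definitions.RawMonoid as RawMonoidDefinitions
import Algebra.Properties.Group as GroupProperties
open import Data.Bool.Base using (if_then_else_)
open import Data.Fin.Base using (Fin; zero; suc)
open import Data.Fin.Properties using (all?; inj⇒≟)
open import Data.Fin.Subset using (Subset; Nonempty; inside; outside; _∈_)
open import Data.Integer.Base as ℤ using (ℤ; +_; -[1+_])
open import Data.Integer.Divisibility.Signed as ℤ∣
  using () renaming (_∣_ to _∣ᶻ_; _∣?_ to _∣ᶻ?_)
import Data.Integer.Properties as ℤ
open import Data.Integer.Solver using (module +-*-Solver)
open import Data.List.Base as List using (List; []; _∷_; _++_; length; filter; upTo)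
import Data.List.Membership.Propositional as List
open import Data.List.Membership.Propositional.Properties using (∈-map⁺; ∈-upTo⁺)
import Data.List.Relation.Unary.Any as Any
open import Data.Nat.Base using (ℕ; zero; suc; _*_; _^_; _≤_; s≤s; _/_; NonTrivial; nonTrivial⇒nonZero)
import Data.Nat.Properties as ℕ
open import Data.Product.Base using (∃-syntax; _×_; _,_)
open import Data.Rational.Unnormalised.Base as ℚᵘ using (ℚᵘ)
open import Data.Vec.Base using ([]; _∷_; lookup; here; there)
open import Data.Vec.Functional using (Vector; head; tail)
open import Function.Base using (_∘_)
open import Function.Bundles using (Inverse)
open import Function.Properties.Inverse using (Inverse⇒Injection)
open import Level using (Level; 0ℓ; _⊔_)
open import Relation.Binary.Definitions using (Decidable)
open import Relation.Binary.PropositionalEquality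
  using (_≡_; refl; subst; setoid)
open import Relation.Nullary.Decidable using (map′; ¬?; _×-dec_)
open import Relation.Nullary.Negation using (¬_)
open import Relation.Unary using (Pred)
import Relation.Unary as Unary

private
  variable
    c ℓ c′ ℓ′ p : Level

IsLeastPositive : Pred ℕ p → Pred ℕ p
IsLeastPositive P t = 1 ≤ t × P t × (∀ s → 1 ≤ s → P s → t ≤ s)

-- ℤ/mℤ, with carrier ℤ and congruence modulo m as its equality.
Cyclic : ℕ → AbelianGroup 0ℓ 0ℓ
Cyclic m = record
  { Carrier = ℤ
  ; _≈_     = _≈_
  ; _∙_     = ℤ._+_
  ; ε       = ℤ.0ℤ
  ; _⁻¹     = ℤ.-_
  ; isAbelianGroup = record
    { isGroup = record
      { isMonoid = record
        { isSemigroup = record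
          { isMagma = record
            { isEquivalence = record
              { refl  = λ {x} → ≈-reflexive {x} refl
              ; sym   = λ {x} {y} x≈y →
                  subst (+ m ∣ᶻ_) (negate x y) (ℤ∣.∣m⇒∣-m x≈y)
              ; trans = λ {x} {y} {z} x≈y y≈z →
                  subst (+ m ∣ᶻ_) (telescope x y z) (ℤ∣.∣m∣n⇒∣m+n x≈y y≈z)
              }
            ; ∙-cong = λ {x} {y} {u} {v} x≈y u≈v →
                subst (+ m ∣ᶻ_) (interchange x y u v) (ℤ∣.∣m∣n⇒∣m+n x≈y u≈v)
            }
          ; assoc = λ x y z → ≈-reflexive (ℤ.+-assoc x y z)
          }
        ; identity = (λ x → ≈-reflexive (ℤ.+-identityˡ x))
                   , (λ x → ≈-reflexive (ℤ.+-identityʳ x))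
        }
      ; inverse = (λ x → ≈-reflexive (ℤ.+-inverseˡ x))
                , (λ x → ≈-reflexive (ℤ.+-inverseʳ x))
      ; ⁻¹-cong = λ {x} {y} x≈y →
          subst (+ m ∣ᶻ_) (negate′ x y) (ℤ∣.∣m⇒∣-m x≈y)
      }
    ; comm = λ x y → ≈-reflexive (ℤ.+-comm x y)
    }
  }
  where
  open +-*-Solver

  _≈_ : ℤ → ℤ → Set
  x ≈ y = + m ∣ᶻ x ℤ.- y

  ≈-reflexive : ∀ {x y} → x ≡ y → x ≈ y
  ≈-reflexive {x} refl = ℤ∣.divides ℤ.0ℤ (ℤ.+-inverseʳ x)

  negate : ∀ x y → ℤ.- (x ℤ.- y) ≡ y ℤ.- x
  negate = solve 2 (λ x y → :- (x :- y) := y :- x) refl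

  negate′ : ∀ x y → ℤ.- (x ℤ.- y) ≡ (ℤ.- x) ℤ.- (ℤ.- y)
  negate′ = solve 2 (λ x y → :- (x :- y) := (:- x) :- (:- y)) refl

  telescope : ∀ x y z → (x ℤ.- y) ℤ.+ (y ℤ.- z) ≡ x ℤ.- z
  telescope = solve 3 (λ x y z → (x :- y) :+ (y :- z) := x :- z) refl

  interchange : ∀ x y u v →
    (x ℤ.- y) ℤ.+ (u ℤ.- v) ≡ (x ℤ.+ u) ℤ.- (y ℤ.+ v)
  interchange = solve 4 (λ x y u v → (x :- y) :+ (u :- v) := (x :+ u) :- (y :+ v)) refl

_⊕_ : AbelianGroup c ℓ → AbelianGroup c′ ℓ′ → AbelianGroup (c ⊔ c′) (ℓ ⊔ ℓ′)
_⊕_ = DirectProduct.abelianGroup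

Power : AbelianGroup c ℓ → ℕ → AbelianGroup c ℓ
Power G r = Pointwise.abelianGroup (Fin r) G

IsFinite : AbelianGroup c ℓ → Set (c ⊔ ℓ)
IsFinite G = ∃[ h ] Inverse (AbelianGroup.setoid G) (setoid (Fin h))

DecidableEquality : AbelianGroup c ℓ → Set (c ⊔ ℓ)
DecidableEquality G = Decidable (AbelianGroup._≈_ G)

module _ (G : AbelianGroup c ℓ) where
  open AbelianGroup G

  multiple : ℤ → Carrier → Carrier
  multiple (+ n)    x = RawMonoidDefinitions._×_ rawMonoid n x
  multiple -[1+ n ] x = (RawMonoidDefinitions._×_ rawMonoid (suc n) x) ⁻¹

  IsExponent : ℕ → Set (c ⊔ ℓ)
  IsExponent = IsLeastPositive (λ e → ∀ x → multiple (+ e) x ≈ ε)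

module _ (G : AbelianGroup c ℓ) (A : Pred ℤ 0ℓ) where
  open AbelianGroup G

  -- The values of the weights a outside I are irrelevant.
  weightedSum : ∀ {m} → Vector Carrier m → Subset m → (Fin m → ℤ) → Carrier
  weightedSum S I a = RawMonoidDefinitions.sum rawMonoid
    (λ i → if lookup I i then multiple G (a i) (S i) else ε)

  IsWeightedSum : ∀ {m} → Vector Carrier m → Carrier → Subset m → Set ℓ
  IsWeightedSum S g I =
    ∃[ a ] (∀ i → i ∈ I → A (a i)) × weightedSum S I a ≈ g

  IsDavenportConstant : ℕ → Set (c ⊔ ℓ)
  IsDavenportConstant = IsLeastPositive (λ t →
    (S : Vector Carrier t) → ∃[ I ] Nonempty I × IsWeightedSum S ε I)

allSubsets : ∀ m → List (Subset m)
allSubsets zero    = [] ∷ []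
allSubsets (suc m) =
  List.map (outside ∷_) (allSubsets m) ++ List.map (inside ∷_) (allSubsets m)

-- N_{A,g}(S). The value does not depend on the decision procedure.
numSubsets : (G : AbelianGroup c ℓ) (A : Pred ℤ 0ℓ) →
  ∀ {m} (S : Vector (AbelianGroup.Carrier G) m) (g : AbelianGroup.Carrier G) →
  Unary.Decidable (IsWeightedSum G A S g) → ℕ
numSubsets G A {m} S g weightedSum? = length (filter weightedSum? (allSubsets m))

quotient : (d n k j : ℕ) .{{_ : NonTrivial d}} → ℕ
quotient d n k j = ((d ^ k * n) / (d ^ j)) {{ℕ.m^n≢0 d j {{nonTrivial⇒nonZero d}}}}

-- {1, …, dᵏn - 1} ∖ {dᵏn / dʲ : j ∈ [1, k]}
weightSet : (d n k : ℕ) .{{_ : NonTrivial d}} → Pred ℤ 0ℓ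
weightSet d n k a =
  + 1 ℤ.≤ a × a ℤ.< + (d ^ k * n) ×
  ¬ (∃[ j ] 1 ≤ j × j ≤ k × a ≡ + quotient d n k j)

2^ᶻ_ : ℤ → ℚᵘ
2^ᶻ (+ n)    = (+ (2 ^ n)) ℚᵘ./ 1
2^ᶻ -[1+ n ] = ((+ 1) ℚᵘ./ (2 ^ suc n)) {{ℕ.m^n≢0 2 (suc n)}}

IsFinite⇒decidable : (G : AbelianGroup c ℓ) → IsFinite G → DecidableEquality G
IsFinite⇒decidable G (_ , inv) = inj⇒≟ (Inverse⇒Injection inv)

Cyclic-decidable : ∀ m → DecidableEquality (Cyclic m)
Cyclic-decidable m x y = + m ∣ᶻ? x ℤ.- y

⊕-decidable : (G : AbelianGroup c ℓ) (H : AbelianGroup c′ ℓ′) →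
  DecidableEquality G → DecidableEquality H → DecidableEquality (G ⊕ H)
⊕-decidable _ _ _≟₁_ _≟₂_ (x , y) (x′ , y′) = (x ≟₁ x′) ×-dec (y ≟₂ y′)

Power-decidable : (G : AbelianGroup c ℓ) (r : ℕ) →
  DecidableEquality G → DecidableEquality (Power G r)
Power-decidable _ _ _≟_ x y = all? (λ i → x i ≟ y i)

weightSet? : (d n k : ℕ) .{{_ : NonTrivial d}} → Unary.Decidable (weightSet d n k)
weightSet? d n k a =
  (+ 1 ℤ.≤? a) ×-dec (a ℤ.<? + (d ^ k * n)) ×-dec
  ¬? (map′ (λ (j , j<1+k , 1≤j , eq) → j , 1≤j , ℕ.≤-pred j<1+k , eq)
           (λ (j , 1≤j , j≤k , eq) → j , s≤s j≤k , 1≤j , eq)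
           (ℕ.anyUpTo? (λ j → (1 ℕ.≤? j) ×-dec (a ℤ.≟ + quotient d n k j)) (suc k)))

weightSet-enumerated : (d n k : ℕ) .{{_ : NonTrivial d}} →
  ∀ {a} → weightSet d n k a → a List.∈ List.map +_ (upTo (d ^ k * n))
weightSet-enumerated d n k {+ _}       (_ , ℤ.+<+ a<m , _) = ∈-map⁺ +_ (∈-upTo⁺ a<m)
weightSet-enumerated d n k { -[1+ _ ]} (() , _)

module _ (G : AbelianGroup c ℓ) (_≟_ : DecidableEquality G)
         {A : Pred ℤ 0ℓ} (A? : Unary.Decidable A)
         (as : List ℤ) (A⊆as : ∀ {a} → A a → a List.∈ as) where
  open AbelianGroup G using (group)
  open Group group renaming (refl to ≈-refl; trans to ≈-trans; sym to ≈-sym)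
  open GroupProperties group using (\\-leftDividesˡ; \\-leftDividesʳ)

  isWeightedSum? : ∀ {m} (S : Vector Carrier m) (g : Carrier) →
    Unary.Decidable (IsWeightedSum G A S g)
  isWeightedSum? S g [] = map′
    (λ ε≈g → (λ ()) , (λ ()) , ε≈g)
    (λ (_ , _ , ε≈g) → ε≈g)
    (ε ≟ g)
  isWeightedSum? {suc m} S g (outside ∷ I) = map′ to from (isWeightedSum? (tail S) g I)
    where
    to : IsWeightedSum G A (tail S) g I → IsWeightedSum G A S g (outside ∷ I)
    to (a , a∈A , eq) = a′ , (λ { (suc i) (there i∈I) → a∈A i i∈I }) , ≈-trans (identityˡ _) eq
      where
      a′ : Fin (suc m) → ℤ
      a′ zero    = ℤ.0ℤ
      a′ (suc i) = a i
    from : IsWeightedSum G A S g (outside ∷ I) → IsWeightedSum G A (tail S) g I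
    from (a , a∈A , eq) = a ∘ suc , (λ i → a∈A (suc i) ∘ there) , ≈-trans (≈-sym (identityˡ _)) eq
  isWeightedSum? {suc m} S g (inside ∷ I) = map′ to from
    (Any.any? (λ b → A? b ×-dec isWeightedSum? (tail S) (rest b) I) as)
    where
    rest : ℤ → Carrier
    rest b = multiple G b (head S) \\ g
    Q : ℤ → Set ℓ
    Q b = A b × IsWeightedSum G A (tail S) (rest b) I
    to : Any.Any Q as → IsWeightedSum G A S g (inside ∷ I)
    to any with b , b∈A , a , a∈A , eq ← Any.satisfied any =
      a′ , (λ { zero here → b∈A ; (suc i) (there i∈I) → a∈A i i∈I })
         , ≈-trans (∙-congˡ eq) (\\-leftDividesˡ _ _)
      where
      a′ : Fin (suc m) → ℤ
      a′ zero    = b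
      a′ (suc i) = a i
    from : IsWeightedSum G A S g (inside ∷ I) → Any.Any Q as
    from (a , a∈A , eq) = Any.map
      (λ { refl → a∈A zero here , a ∘ suc , (λ i → a∈A (suc i) ∘ there)
         , ≈-trans (≈-sym (\\-leftDividesʳ _ _)) (∙-congˡ eq) })
      (A⊆as (a∈A zero here))

weightedSum? : (H : AbelianGroup c ℓ) → IsFinite H →
  (d n k r : ℕ) .{{_ : NonTrivial d}} →
  let G = H ⊕ Power (Cyclic (d ^ k * n)) r in
  ∀ {m} (S : Vector (AbelianGroup.Carrier G) m) (g : AbelianGroup.Carrier G) →
  Unary.Decidable (IsWeightedSum G (weightSet d n k) S g)
weightedSum? H finite d n k r = isWeightedSum? (H ⊕ Power C r)
  (⊕-decidable H (Power C r) (IsFinite⇒decidable H finite)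
    (Power-decidable C r (Cyclic-decidable (d ^ k * n))))
  (weightSet? d n k) (List.map +_ (upTo (d ^ k * n))) (weightSet-enumerated d n k)
  where
  C : AbelianGroup 0ℓ 0ℓ
  C = Cyclic (d ^ k * n)

{-# OPTIONS --safe #-}
module Submission where

-- Let p be a prime divisor of n and put m = dᵏn, c = m/p. As d ∤ n, none of c, 2c, …, (p-1)c has the form m/dʲ,
-- so all of them lie in A; moreover exp(H) ∣ c. Hence weights in {c, …, (p-1)c} annihilate H and act on C_mʳ as the
-- nonzero elements of 𝔽ₚ. The supports of the vectors in the kernel of an r × l matrix over 𝔽ₚ number at least 2^(l-r):
-- delete a zero column (both choices of its coordinate extend a kernel vector), or eliminate a row and a column with
-- a pivot in the column (a kernel vector of the smaller matrix extends, and its support is recovered by restriction).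
-- On the other hand the standard basis of C_mʳ shows D_A(G) > r.

open import Defs
open import Algebra.Bundles using (AbelianGroup)
import Algebra.Properties.Monoid.Mult as Mult
import Algebra.Properties.Monoid.Sum as MonoidSum
import Algebra.Properties.Semiring.Sum as Sum
open import Data.Bool.Base using (true; false; if_then_else_)
open import Data.Fin.Base using (Fin; zero; suc; inject≤; punchIn; punchOut)
import Data.Fin.Properties as Fin
open import Data.Fin.Subset using (Subset; inside; outside; _∈_; _∉_)
open import Data.Integer.Base as ℤ using (ℤ; +_; -[1+_])
open import Data.Integer.Divisibility.Signed as ℤ∣ using () renaming (_∣_ to _∣ᶻ_; _∣?_ to _∣ᶻ?_)
open import Data.Integer.DivMod using (_/ℕ_; _%ℕ_; a≡a%ℕn+[a/ℕn]*n; n%ℕd<d)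
import Data.Integer.Properties as ℤ
open import Data.Integer.Tactic.RingSolver using (solve-∀)
open import Data.List.Base as List using (List; []; _∷_; _++_; length; filter)
open import Data.List.Properties using (filter-++; filter-accept; length-++)
open import Data.List.Relation.Unary.All using (_∷_)
open import Data.Nat.Base as ℕ
  using (ℕ; zero; suc; _+_; _*_; _^_; _∸_; _≤_; _<_; _≥_; z≤n; s≤s; NonZero; NonTrivial; nonTrivial⇒nonZero; nonTrivial⇒n>1)
open import Data.Nat.Divisibility using (_∣_; divides; divides-refl; ∣-refl; ∣-trans; m∣m*n; ∣⇒≤)
open import Data.Nat.DivMod using (m/n*n≡m)
open import Data.Nat.GCD using (gcd; gcd-greatest; gcd[m,n]≢0)
open import Data.Nat.Primality using (Prime; euclidsLemma; prime⇒nonZero; prime⇒nonTrivial)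
open import Data.Nat.Primality.Factorisation using (factorise)
import Data.Nat.Properties as ℕ
open import Data.Product.Base using (∃-syntax; Σ-syntax; _×_; _,_; proj₁; proj₂)
open import Data.Rational.Unnormalised.Base as ℚᵘ using (_/_)
open import Data.Sum.Base using (_⊎_; inj₁; inj₂; [_,_]′)
open import Data.Vec.Base using ([]; _∷_; lookup; here; there)
open import Data.Vec.Functional using (Vector) renaming (_∷_ to _∷ᵛ_)
import Data.Vec.Properties as Vec
open import Function.Base using (_∘_)
open import Level using (Level; 0ℓ)
open import Relation.Binary.PropositionalEquality
  using (_≡_; _≢_; refl; sym; trans; cong; cong₂; subst; module ≡-Reasoning)
open import Relation.Nullary.Decidable using (Dec; yes; no; ¬?; _⊎-dec_; decidable-stable; does)
open import Relation.Nullary.Negation using (¬_; contradiction)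
open import Relation.Unary using (Pred)
import Relation.Unary as Unary

open Sum ℤ.+-*-semiring using (sum; sum-cong-≗; sum-replicate-zero; *-distribˡ-sum; *-distribʳ-sum; ∑-distrib-+)

private
  variable
    o c ℓ p q : Level
    X Y : Set o

-- Counting the subsets that satisfy a decidable predicate

length-filter-map : {P : Pred Y p} (P? : Unary.Decidable P) (f : X → Y) (xs : List X) →
  length (filter P? (List.map f xs)) ≡ length (filter (P? ∘ f) xs)
length-filter-map P? f [] = refl
length-filter-map P? f (x ∷ xs) with does (P? (f x))
... | true  = cong suc (length-filter-map P? f xs)
... | false = length-filter-map P? f xs

-- Used after elimination: a set `I` counted once there is charged to `outside ∷ I` or to
-- `inside ∷ I`.
length-filter-∪ : {P : Pred X p} {Q : Pred X q}
  (P? : Unary.Decidable P) (Q? : Unary.Decidable Q) (xs : List X) →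
  length (filter (λ x → P? x ⊎-dec Q? x) xs) ≤ length (filter P? xs) + length (filter Q? xs)
length-filter-∪ P? Q? [] = z≤n
length-filter-∪ P? Q? (x ∷ xs) with ih ← length-filter-∪ P? Q? xs | does (P? x) | does (Q? x)
... | true  | true  = s≤s (ℕ.≤-trans ih (ℕ.+-monoʳ-≤ _ (ℕ.n≤1+n _)))
... | true  | false = s≤s ih
... | false | true  = ℕ.≤-trans (s≤s ih) (ℕ.≤-reflexive (sym (ℕ.+-suc _ _)))
... | false | false = ih

length-filter-allSubsets : ∀ {l} {P : Pred (Subset (suc l)) p} (P? : Unary.Decidable P) →
  length (filter P? (allSubsets (suc l))) ≡
  length (filter (P? ∘ (outside ∷_)) (allSubsets l)) + length (filter (P? ∘ (inside ∷_)) (allSubsets l))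
length-filter-allSubsets {l = l} P? = begin
  length (filter P? (List.map (outside ∷_) Is ++ List.map (inside ∷_) Is))
    ≡⟨ cong length (filter-++ P? (List.map (outside ∷_) Is) _) ⟩
  length (filter P? (List.map (outside ∷_) Is) ++ filter P? (List.map (inside ∷_) Is))
    ≡⟨ length-++ (filter P? (List.map (outside ∷_) Is)) ⟩
  length (filter P? (List.map (outside ∷_) Is)) + length (filter P? (List.map (inside ∷_) Is))
    ≡⟨ cong₂ _+_ (length-filter-map P? (outside ∷_) Is) (length-filter-map P? (inside ∷_) Is) ⟩
  length (filter (P? ∘ (outside ∷_)) Is) + length (filter (P? ∘ (inside ∷_)) Is) ∎
  where
  open ≡-Reasoning
  Is = allSubsets l

-- Divisibility of integer sums and products

∣-sum : ∀ {m l} (f : Vector ℤ l) → (∀ i → m ∣ᶻ f i) → m ∣ᶻ sum f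
∣-sum {l = zero}  f m∣f = ℤ∣.divides ℤ.0ℤ refl
∣-sum {l = suc l} f m∣f = ℤ∣.∣m∣n⇒∣m+n (m∣f zero) (∣-sum (f ∘ suc) (m∣f ∘ suc))

module _ {p : ℕ} (p-prime : Prime p) where

  euclidsLemmaᶻ : ∀ x y → + p ∣ᶻ x ℤ.* y → + p ∣ᶻ x ⊎ + p ∣ᶻ y
  euclidsLemmaᶻ x y p∣xy with euclidsLemma ℤ.∣ x ∣ ℤ.∣ y ∣ p-prime (subst (p ∣_) (ℤ.abs-* x y) (ℤ∣.∣⇒∣ᵤ p∣xy))
  ... | inj₁ p∣x = inj₁ (ℤ∣.∣ᵤ⇒∣ p∣x)
  ... | inj₂ p∣y = inj₂ (ℤ∣.∣ᵤ⇒∣ p∣y)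

  prime∤1 : ¬ (+ p ∣ᶻ + 1)
  prime∤1 p∣1 = ℕ.<⇒≱ (nonTrivial⇒n>1 p {{prime⇒nonTrivial p-prime}}) (∣⇒≤ (ℤ∣.∣⇒∣ᵤ p∣1))

-- Kernel supports of matrices over 𝔽ₚ

-- I is the support of a vector in the kernel over 𝔽ₚ of the matrix with columns S.
IsKernelSupport : (p : ℕ) {l r : ℕ} → Vector (Vector ℤ r) l → Pred (Subset l) 0ℓ
IsKernelSupport p {l} S I = Σ[ x ∈ Vector ℤ l ]
  (∀ i → i ∈ I → ¬ (+ p ∣ᶻ x i)) × (∀ i → i ∉ I → + p ∣ᶻ x i) ×
  (∀ j → + p ∣ᶻ sum (λ i → x i ℤ.* S i j))

module _ {p : ℕ} (p-prime : Prime p) where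

  -- With new coordinate 0 the first column contributes nothing, whatever its entries are.
  outside-zeroColumn : ∀ {l r} (S : Vector (Vector ℤ r) (suc l)) {I} →
    IsKernelSupport p (S ∘ suc) I → IsKernelSupport p S (outside ∷ I)
  outside-zeroColumn S (x , x∈ , x∉ , ker) = (ℤ.0ℤ ∷ᵛ x)
    , (λ { (suc i) (there i∈I) → x∈ i i∈I })
    , (λ { zero _ → ℤ∣.divides ℤ.0ℤ refl ; (suc i) i∉I → x∉ i (i∉I ∘ there) })
    , (λ j → subst (+ p ∣ᶻ_) (sym (ℤ.+-identityˡ _)) (ker j))

  -- The new coordinate can be any unit modulo p, here 1, because its column vanishes modulo p.
  inside-zeroColumn : ∀ {l r} (S : Vector (Vector ℤ r) (suc l)) → (∀ j → + p ∣ᶻ S zero j) → ∀ {I} →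
    IsKernelSupport p (S ∘ suc) I → IsKernelSupport p S (inside ∷ I)
  inside-zeroColumn S p∣S₀ (x , x∈ , x∉ , ker) = ((+ 1) ∷ᵛ x)
    , (λ { zero _ → prime∤1 p-prime ; (suc i) (there i∈I) → x∈ i i∈I })
    , (λ { zero 0∉I → contradiction here 0∉I ; (suc i) i∉I → x∉ i (i∉I ∘ there) })
    , (λ j → ℤ∣.∣m∣n⇒∣m+n (ℤ∣.∣n⇒∣m*n (+ 1) (p∣S₀ j)) (ker j))

  -- One step of Gaussian elimination with pivot S₀ⱼ, free of division.
  eliminate : ∀ {l r} → Vector (Vector ℤ (suc r)) (suc l) → Fin (suc r) → Vector (Vector ℤ r) l
  eliminate S j i j′ = S zero j ℤ.* S (suc i) (punchIn j j′) ℤ.- S (suc i) j ℤ.* S zero (punchIn j j′)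

  -- Scaling `x` by the pivot `b`, a unit modulo p, keeps its support; a first coordinate is then
  -- solved for. Whether p divides that coordinate decides between the two alternatives.
  kernelSupport-eliminate : ∀ {l r} (S : Vector (Vector ℤ (suc r)) (suc l)) j → ¬ (+ p ∣ᶻ S zero j) → ∀ {I} →
    IsKernelSupport p (eliminate S j) I → IsKernelSupport p S (outside ∷ I) ⊎ IsKernelSupport p S (inside ∷ I)
  kernelSupport-eliminate {l} {r} S j p∤b {I} (x , x∈ , x∉ , ker) = go (+ p ∣ᶻ? x₀)
    where
    b x₀ : ℤ
    b  = S zero j
    -- Chosen so that row `j` of the extended system, b x₀ + Σ b xᵢ Sᵢⱼ, is exactly 0.
    x₀ = ℤ.- sum (λ i → x i ℤ.* S (suc i) j)

    y : Vector ℤ (suc l)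
    y = x₀ ∷ᵛ (λ i → b ℤ.* x i)

    -- Indexed by all rows, including the pivot row that `eliminate` drops, so that a single
    -- identity serves every row of `S`.
    eliminated : Fin (suc r) → Fin l → ℤ
    eliminated j′ i = x i ℤ.* (b ℤ.* S (suc i) j′ ℤ.- S (suc i) j ℤ.* S zero j′)

    sum-eliminated : ∀ j′ → sum (eliminated j′) ≡ sum (λ i → y i ℤ.* S i j′)
    sum-eliminated j′ = begin
      sum (eliminated j′)
        ≡⟨ sum-cong-≗ (λ i → expand (x i) b (S (suc i) j′) (S (suc i) j) (S zero j′)) ⟩
      sum (λ i → x i ℤ.* S (suc i) j ℤ.* (ℤ.- S zero j′) ℤ.+ b ℤ.* x i ℤ.* S (suc i) j′)
        ≡⟨ ∑-distrib-+ (λ i → x i ℤ.* S (suc i) j ℤ.* (ℤ.- S zero j′)) _ ⟩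
      sum (λ i → x i ℤ.* S (suc i) j ℤ.* (ℤ.- S zero j′)) ℤ.+ sum (λ i → b ℤ.* x i ℤ.* S (suc i) j′)
        ≡⟨ cong (ℤ._+ sum (λ i → b ℤ.* x i ℤ.* S (suc i) j′)) (trans
             (sym (*-distribʳ-sum (ℤ.- S zero j′) (λ i → x i ℤ.* S (suc i) j)))
             (moveSign (sum (λ i → x i ℤ.* S (suc i) j)) (S zero j′))) ⟩
      x₀ ℤ.* S zero j′ ℤ.+ sum (λ i → b ℤ.* x i ℤ.* S (suc i) j′) ∎
      where
      open ≡-Reasoning
      expand : ∀ x b s t u → x ℤ.* (b ℤ.* s ℤ.- t ℤ.* u) ≡ x ℤ.* t ℤ.* (ℤ.- u) ℤ.+ b ℤ.* x ℤ.* s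
      expand = solve-∀
      moveSign : ∀ s t → s ℤ.* (ℤ.- t) ≡ (ℤ.- s) ℤ.* t
      moveSign = solve-∀

    -- In the pivot row every term cancels; any other row is a row of `eliminate S j`, found by
    -- `punchOut`.
    p∣sum-eliminated : ∀ j′ → + p ∣ᶻ sum (eliminated j′)
    p∣sum-eliminated j′ with j Fin.≟ j′
    ... | yes refl = ∣-sum (eliminated j)
      (λ i → ℤ∣.divides ℤ.0ℤ (cancel (x i) b (S (suc i) j)))
      where
      cancel : ∀ x b s → x ℤ.* (b ℤ.* s ℤ.- s ℤ.* b) ≡ ℤ.0ℤ
      cancel = solve-∀
    ... | no j≢j′ = subst (λ k → + p ∣ᶻ sum (eliminated k)) (Fin.punchIn-punchOut j≢j′) (ker (punchOut j≢j′))

    y-ker : ∀ j′ → + p ∣ᶻ sum (λ i → y i ℤ.* S i j′)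
    y-ker j′ = subst (+ p ∣ᶻ_) (sum-eliminated j′) (p∣sum-eliminated j′)

    y∈ : ∀ i → i ∈ I → ¬ (+ p ∣ᶻ y (suc i))
    y∈ i i∈I = [ p∤b , x∈ i i∈I ]′ ∘ euclidsLemmaᶻ p-prime b (x i)

    y∉ : ∀ i → i ∉ I → + p ∣ᶻ y (suc i)
    y∉ i i∉I = ℤ∣.∣n⇒∣m*n b (x∉ i i∉I)

    go : Dec (+ p ∣ᶻ x₀) → IsKernelSupport p S (outside ∷ I) ⊎ IsKernelSupport p S (inside ∷ I)
    go (yes p∣x₀) = inj₁ (y
      , (λ { (suc i) (there i∈I) → y∈ i i∈I })
      , (λ { zero _ → p∣x₀ ; (suc i) i∉I → y∉ i (i∉I ∘ there) })
      , y-ker)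
    go (no p∤x₀) = inj₂ (y
      , (λ { zero _ → p∤x₀ ; (suc i) (there i∈I) → y∈ i i∈I })
      , (λ { zero 0∉I → contradiction here 0∉I ; (suc i) i∉I → y∉ i (i∉I ∘ there) })
      , y-ker)

  -- Induction on `l`. A general `P` is needed because the pivot case applies the induction
  -- hypothesis to the predicate that `outside ∷ I` or `inside ∷ I` satisfies `P`. The factor 2^r on
  -- the right avoids the exponent l - r, which may be negative.
  2^l≤2^r*#kernelSupports : ∀ l r (S : Vector (Vector ℤ r) l) {P : Pred (Subset l) ℓ} (P? : Unary.Decidable P) →
    (∀ {I} → IsKernelSupport p S I → P I) → 2 ^ l ≤ 2 ^ r * length (filter P? (allSubsets l))
  -- The empty set supports the empty kernel vector, so the count is 1.
  2^l≤2^r*#kernelSupports zero r S P? S⇒P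
    rewrite filter-accept P? {xs = []} (S⇒P {[]} ((λ ()) , (λ ()) , (λ ()) , λ _ → ℤ∣.divides ℤ.0ℤ refl))
          | ℕ.*-identityʳ (2 ^ r) = ℕ.m^n>0 2 r
  2^l≤2^r*#kernelSupports (suc l) r S P? S⇒P with Fin.any? (λ j → ¬? (+ p ∣ᶻ? S zero j))
  -- The first column is zero modulo p, so each support for the remaining columns yields two.
  2^l≤2^r*#kernelSupports (suc l) r S P? S⇒P | no ∄pivot = begin
    2 * 2 ^ l                      ≡⟨ cong (2 ^ l ℕ.+_) (ℕ.+-identityʳ _) ⟩
    2 ^ l + 2 ^ l
      ≤⟨ ℕ.+-mono-≤
           (2^l≤2^r*#kernelSupports l r (S ∘ suc) _ (S⇒P ∘ outside-zeroColumn S))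
           (2^l≤2^r*#kernelSupports l r (S ∘ suc) _ (S⇒P ∘ inside-zeroColumn S p∣S₀)) ⟩
    2 ^ r * _ + 2 ^ r * _          ≡⟨ ℕ.*-distribˡ-+ (2 ^ r) _ _ ⟨
    2 ^ r * _                      ≡⟨ cong (2 ^ r *_) (length-filter-allSubsets P?) ⟨
    2 ^ r * length (filter P? (allSubsets (suc l))) ∎
    where
    open ℕ.≤-Reasoning
    p∣S₀ : ∀ j → + p ∣ᶻ S zero j
    p∣S₀ j = decidable-stable (+ p ∣ᶻ? S zero j) (λ p∤ → ∄pivot (j , p∤))
  -- A pivot row exists, so `r` is a successor here. Removing one row and one column takes a factor
  -- 2 from both sides.
  2^l≤2^r*#kernelSupports (suc l) (suc r) S P? S⇒P | yes (j , p∤S₀ⱼ) = begin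
    2 * 2 ^ l
      ≤⟨ ℕ.*-monoʳ-≤ 2 (2^l≤2^r*#kernelSupports l r (eliminate S j)
           (λ I → P? (outside ∷ I) ⊎-dec P? (inside ∷ I))
           ([ inj₁ ∘ S⇒P , inj₂ ∘ S⇒P ]′ ∘ kernelSupport-eliminate S j p∤S₀ⱼ)) ⟩
    2 * (2 ^ r * _)                ≡⟨ ℕ.*-assoc 2 (2 ^ r) _ ⟨
    2 ^ suc r * _
      ≤⟨ ℕ.*-monoʳ-≤ (2 ^ suc r) (length-filter-∪ (P? ∘ (outside ∷_)) (P? ∘ (inside ∷_)) (allSubsets l)) ⟩
    2 ^ suc r * _                  ≡⟨ cong (2 ^ suc r *_) (length-filter-allSubsets P?) ⟨
    2 ^ suc r * length (filter P? (allSubsets (suc l))) ∎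
    where open ℕ.≤-Reasoning

-- Prime divisors, one-term sums and multiples in `Cyclic m`

∃-primeDivisor : ∀ n .{{_ : NonTrivial n}} → ∃[ p ] Prime p × p ∣ n
∃-primeDivisor n with factorise n {{nonTrivial⇒nonZero n}}
... | record { factors = [] ; isFactorisation = n≡1 } =
  contradiction n≡1 (ℕ.nonTrivial⇒≢1 {n})
... | record { factors = p ∷ ps ; isFactorisation = n≡p*ps ; factorsPrime = p-prime ∷ _ } =
  p , p-prime , subst (p ∣_) (sym n≡p*ps) (m∣m*n _)

sum-zero : ∀ {l} (f : Vector ℤ l) → (∀ i → f i ≡ ℤ.0ℤ) → sum f ≡ ℤ.0ℤ
sum-zero {l} f f≡0 = trans (sum-cong-≗ f≡0) (sum-replicate-zero l)

sum-single : ∀ {l} (f : Vector ℤ l) i → (∀ j → j ≢ i → f j ≡ ℤ.0ℤ) → sum f ≡ f i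
sum-single f zero f≡0 = trans
  (cong (ℤ._+_ (f zero)) (sum-zero (f ∘ suc) (λ j → f≡0 (suc j) (λ ()))))
  (ℤ.+-identityʳ (f zero))
sum-single f (suc i) f≡0 = trans
  (cong₂ ℤ._+_ (f≡0 zero (λ ())) (sum-single (f ∘ suc) i (λ j j≢i → f≡0 (suc j) (j≢i ∘ Fin.suc-injective))))
  (ℤ.+-identityˡ (f (suc i)))

δ : ∀ {r} → Fin r → Vector ℤ r
δ i j = if does (i Fin.≟ j) then + 1 else ℤ.0ℤ

-- An equality of integers, not just a congruence modulo m, so that coordinates of weighted sums can
-- be computed in ℤ.
multiple-Cyclic : ∀ m a x → multiple (Cyclic m) a x ≡ a ℤ.* x
multiple-Cyclic m (+ n) x = nonNeg n
  where
  nonNeg : ∀ n → multiple (Cyclic m) (+ n) x ≡ + n ℤ.* x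
  nonNeg zero    = refl
  nonNeg (suc n) = trans (cong (ℤ._+_ x) (nonNeg n)) (sym (ℤ.suc-* (+ n) x))
multiple-Cyclic m -[1+ n ] x = trans
  (cong ℤ.-_ (multiple-Cyclic m (+ suc n) x)) (ℤ.neg-distribˡ-* (+ suc n) x)

-- Weighted sums in H ⊕ C_mʳ by coordinates

module _ (H : AbelianGroup c ℓ) (m r : ℕ) where
  private
    module H = AbelianGroup H
    G = H ⊕ Power (Cyclic m) r
    module G = AbelianGroup G

  multiple-proj₁ : ∀ a g → proj₁ (multiple G a g) ≡ multiple H a (proj₁ g)
  multiple-proj₁ (+ n) g = nonNeg n
    where
    nonNeg : ∀ n → proj₁ (multiple G (+ n) g) ≡ multiple H (+ n) (proj₁ g)
    nonNeg zero    = refl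
    nonNeg (suc n) = cong (proj₁ g H.∙_) (nonNeg n)
  multiple-proj₁ -[1+ n ] g = cong H._⁻¹ (multiple-proj₁ (+ suc n) g)

  multiple-proj₂ : ∀ a g j → proj₂ (multiple G a g) j ≡ a ℤ.* proj₂ g j
  multiple-proj₂ a g j = trans (coordinate a) (multiple-Cyclic m a (proj₂ g j))
    where
    nonNeg : ∀ n → proj₂ (multiple G (+ n) g) j ≡ multiple (Cyclic m) (+ n) (proj₂ g j)
    nonNeg zero    = refl
    nonNeg (suc n) = cong (ℤ._+_ (proj₂ g j)) (nonNeg n)
    coordinate : ∀ a → proj₂ (multiple G a g) j ≡ multiple (Cyclic m) a (proj₂ g j)
    coordinate (+ n)    = nonNeg n
    coordinate -[1+ n ] = cong ℤ.-_ (nonNeg (suc n))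

  module _ (A : Pred ℤ 0ℓ) where

    weightedSum-proj₁ : ∀ {l} (S : Vector G.Carrier l) I a →
      (∀ i → i ∈ I → multiple H (a i) (proj₁ (S i)) H.≈ H.ε) → proj₁ (weightedSum G A S I a) H.≈ H.ε
    weightedSum-proj₁ S [] a a≈0 = H.refl
    weightedSum-proj₁ S (outside ∷ I) a a≈0 = H.trans (H.identityˡ _)
      (weightedSum-proj₁ (S ∘ suc) I (a ∘ suc) (λ i i∈I → a≈0 (suc i) (there i∈I)))
    weightedSum-proj₁ S (inside ∷ I) a a≈0 = H.trans
      (H.∙-cong (H.trans (H.reflexive (multiple-proj₁ (a zero) (S zero))) (a≈0 zero here))
        (weightedSum-proj₁ (S ∘ suc) I (a ∘ suc) (λ i i∈I → a≈0 (suc i) (there i∈I))))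
      (H.identityˡ _)

    weightedSum-proj₂ : ∀ {l} (S : Vector G.Carrier l) I a j →
      proj₂ (weightedSum G A S I a) j ≡ sum (λ i → if lookup I i then a i ℤ.* proj₂ (S i) j else ℤ.0ℤ)
    weightedSum-proj₂ S [] a j = refl
    weightedSum-proj₂ S (outside ∷ I) a j = cong (ℤ._+_ ℤ.0ℤ) (weightedSum-proj₂ (S ∘ suc) I (a ∘ suc) j)
    weightedSum-proj₂ S (inside ∷ I) a j = cong₂ ℤ._+_
      (multiple-proj₂ (a zero) (S zero) j) (weightedSum-proj₂ (S ∘ suc) I (a ∘ suc) j)

    -- If D ≤ r, take D distinct standard basis vectors. In a zero-sum with `i` in its index set,
    -- the coordinate belonging to `i` equals the weight `a i`, which lies in [1, m-1] and so is not
    -- divisible by m.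
    r<DavenportConstant : (∀ {a} → A a → + 1 ℤ.≤ a × a ℤ.< + m) →
      ∀ {D} → IsDavenportConstant G A D → r < D
    r<DavenportConstant A⊆[1,m-1] {D} (_ , zeroSum , _) = ℕ.≰⇒> λ D≤r →
      let S = λ i → H.ε , δ (inject≤ i D≤r)
          I , (i , i∈I) , a , a∈A , (_ , eq) = zeroSum S
          j = inject≤ i D≤r
          f = λ i′ → if lookup I i′ then a i′ ℤ.* δ (inject≤ i′ D≤r) j else ℤ.0ℤ

          f≡0 : ∀ i′ → i′ ≢ i → f i′ ≡ ℤ.0ℤ
          f≡0 i′ i′≢i = vanish (lookup I i′) (a i′) (inject≤ i′ D≤r) j
            (i′≢i ∘ Fin.inject≤-injective D≤r D≤r i′ i)

          fi≡ai : f i ≡ a i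
          fi≡ai = unit (lookup I i) (Vec.[]=⇒lookup i∈I) (a i) j

          sum≡ai : proj₂ (weightedSum G A S I a) j ≡ a i
          sum≡ai = trans (weightedSum-proj₂ S I a j) (trans (sum-single f i f≡0) fi≡ai)
      in m∤a (a i) (A⊆[1,m-1] (a∈A i i∈I))
           (subst (+ m ∣ᶻ_) (trans (ℤ.+-identityʳ _) sum≡ai) (eq j))
      where
      vanish : ∀ b x (i j : Fin r) → i ≢ j → (if b then x ℤ.* δ i j else ℤ.0ℤ) ≡ ℤ.0ℤ
      vanish false x i j i≢j = refl
      vanish true  x i j i≢j with i Fin.≟ j
      ... | yes i≡j = contradiction i≡j i≢j
      ... | no  _   = ℤ.*-zeroʳ x

      unit : ∀ b → b ≡ true → ∀ x (i : Fin r) → (if b then x ℤ.* δ i i else ℤ.0ℤ) ≡ x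
      unit true refl x i with i Fin.≟ i
      ... | yes _   = ℤ.*-identityʳ x
      ... | no  i≢i = contradiction refl i≢i

      m∤a : ∀ a → + 1 ℤ.≤ a × a ℤ.< + m → ¬ (+ m ∣ᶻ a)
      m∤a (+ suc a) (_ , ℤ.+<+ a<m) m∣a = ℕ.<⇒≱ a<m (∣⇒≤ (ℤ∣.∣⇒∣ᵤ m∣a))
      m∤a (+ zero)  (ℤ.+≤+ () , _)
      m∤a -[1+ _ ]  (() , _)

    -- Take the weights c·(xᵢ mod p). They annihilate H, and each cyclic coordinate of the sum is c
    -- times an integer divisible by p, hence divisible by cp = m.
    kernelSupport⇒zeroSum : ∀ {p} → Prime p → ∀ c → m ≡ c * p →
      (∀ y h → multiple H (+ (c * y)) h H.≈ H.ε) →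
      (∀ {y} → 1 ≤ y → y < p → A (+ (c * y))) →
      ∀ {l} (S : Vector G.Carrier l) {I} → IsKernelSupport p (proj₂ ∘ S) I → IsWeightedSum G A S G.ε I
    kernelSupport⇒zeroSum {p} p-prime c m≡cp cH≈0 c[1,p-1]⊆A {l} S {I} (x , x∈ , x∉ , ker) =
      a , (λ i i∈I → c[1,p-1]⊆A (1≤y i i∈I) (n%ℕd<d (x i) p)) ,
      weightedSum-proj₁ S I a (λ i _ → cH≈0 (y i) (proj₁ (S i))) ,
      λ j → subst (+ m ∣ᶻ_) (sym (ℤ.+-identityʳ _)) (m∣sum j)
      where
      instance
        p≢0 : NonZero p
        p≢0 = prime⇒nonZero p-prime

      y : Fin l → ℕ
      y i = x i %ℕ p

      a : Fin l → ℤ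
      a i = + (c * y i)

      x≡y+ : ∀ i → x i ≡ + y i ℤ.+ (x i /ℕ p) ℤ.* + p
      x≡y+ i = a≡a%ℕn+[a/ℕn]*n (x i) p

      1≤y : ∀ i → i ∈ I → 1 ≤ y i
      1≤y i i∈I = ℕ.n≢0⇒n>0 λ y≡0 → x∈ i i∈I (ℤ∣.divides (x i /ℕ p) (begin
        x i                                  ≡⟨ x≡y+ i ⟩
        + y i ℤ.+ (x i /ℕ p) ℤ.* + p         ≡⟨ cong (λ z → + z ℤ.+ (x i /ℕ p) ℤ.* + p) y≡0 ⟩
        ℤ.0ℤ ℤ.+ (x i /ℕ p) ℤ.* + p          ≡⟨ ℤ.+-identityˡ _ ⟩
        (x i /ℕ p) ℤ.* + p ∎))
        where open ≡-Reasoning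

      module _ (j : Fin r) where
        s : Fin l → ℤ
        s i = proj₂ (S i) j

        f : Fin l → ℤ
        f i = if lookup I i then + y i ℤ.* s i else ℤ.0ℤ

        -- On the support, xᵢ is congruent to its residue; off the support, p divides xᵢ while the
        -- term of `f` is 0.
        f≈xs : ∀ i → + p ∣ᶻ f i ℤ.- x i ℤ.* s i
        f≈xs i with lookup I i in eq
        ... | true = ℤ∣.divides (ℤ.- ((x i /ℕ p) ℤ.* s i))
          (trans (cong (λ z → + y i ℤ.* s i ℤ.- z ℤ.* s i) (x≡y+ i)) (difference (+ y i) (s i) (x i /ℕ p) (+ p)))
          where
          difference : ∀ y s q p → y ℤ.* s ℤ.- (y ℤ.+ q ℤ.* p) ℤ.* s ≡ ℤ.- (q ℤ.* s) ℤ.* p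
          difference = solve-∀
        ... | false = ℤ∣.∣m∣n⇒∣m-n (ℤ∣.divides ℤ.0ℤ refl) (ℤ∣.∣m⇒∣m*n (s i) (x∉ i i∉I))
          where
          i∉I : i ∉ I
          i∉I i∈I = contradiction (trans (sym eq) (Vec.[]=⇒lookup i∈I)) (λ ())

        p∣sum : + p ∣ᶻ sum f
        -- The termwise congruences add up because equality in `Cyclic p` is congruence modulo p and
        -- its operation is integer addition.
        p∣sum = ℤ∣.∣m+n∣n⇒∣m {m = sum f} (CyclicSum.sum-cong-≋ {x = f} f≈xs) (ℤ∣.∣m⇒∣-m (ker j))
          where module CyclicSum = MonoidSum (AbelianGroup.monoid (Cyclic p))

        m∣sum : + m ∣ᶻ proj₂ (weightedSum G A S I a) j
        m∣sum = subst (+ m ∣ᶻ_) (sym sum≡c*sum)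
          (subst (_∣ᶻ + c ℤ.* sum f) (trans (sym (ℤ.pos-* c p)) (cong +_ (sym m≡cp))) (ℤ∣.*-monoʳ-∣ (+ c) p∣sum))
          where
          factor : ∀ i → (if lookup I i then a i ℤ.* s i else ℤ.0ℤ) ≡ + c ℤ.* f i
          factor i with lookup I i
          ... | true  = trans (cong (ℤ._* s i) (ℤ.pos-* c (y i))) (ℤ.*-assoc (+ c) (+ y i) (s i))
          ... | false = sym (ℤ.*-zeroʳ (+ c))

          sum≡c*sum : proj₂ (weightedSum G A S I a) j ≡ + c ℤ.* sum f
          sum≡c*sum = trans (weightedSum-proj₂ S I a j)
            (trans (sum-cong-≗ factor) (sym (*-distribˡ-sum (+ c) f)))

-- The exponent of H and the weights c, 2c, ..., (p-1)c

multiple-exponent : (H : AbelianGroup c ℓ) → let open AbelianGroup H in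
  ∀ {e} → IsExponent H e → ∀ {a} → e ∣ a → ∀ h → multiple H (+ a) h ≈ ε
multiple-exponent H {e} (_ , e≈0 , _) (divides-refl b) h =
  trans≈ (sym≈ (×-assocˡ h b e)) (trans≈ (×-congʳ b (e≈0 h)) (×-zero b))
  where
  open AbelianGroup H renaming (sym to sym≈; trans to trans≈; refl to refl≈)
  open Mult monoid renaming (_×_ to _×ᴴ_)
  ×-zero : ∀ n → n ×ᴴ ε ≈ ε
  ×-zero zero    = refl≈
  ×-zero (suc n) = trans≈ (identityˡ _) (×-zero n)

m^-mono-∣ : ∀ d {j k} → j ≤ k → d ^ j ∣ d ^ k
m^-mono-∣ d {j} {k} j≤k = subst (d ^ j ∣_)
  (trans (sym (ℕ.^-distribˡ-+-* d j (k ∸ j))) (cong (d ^_) (ℕ.m+[n∸m]≡n j≤k))) (m∣m*n _)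

-- If m divided n, it would divide gcd(m, n), which is nonzero and smaller than m.
gcd<m⇒m∤n : ∀ m n .{{_ : NonZero m}} → gcd m n ≤ m ∸ 1 → ¬ (m ∣ n)
gcd<m⇒m∤n m@(suc _) n gcd≤ m∣n =
  ℕ.<⇒≱ (s≤s gcd≤) (∣⇒≤ {{ℕ.≢-nonZero (gcd[m,n]≢0 m n (inj₁ λ ()))}} (gcd-greatest ∣-refl m∣n))

-- With c = dᵏq and m = cp, an excluded value cy = m/dʲ would give y dʲ = p, hence d ∣ p ∣ qp.
weightSet-multiples : ∀ d k q p .{{_ : NonTrivial d}} .{{_ : NonTrivial (q * p)}} → ¬ (d ∣ q * p) →
  ∀ {y} → 1 ≤ y → y < p → weightSet d (q * p) k (+ (d ^ k * q * y))
weightSet-multiples d k q p d∤qp {y} 1≤y y<p = ℤ.+≤+ 1≤c*y , ℤ.+<+ c*y<m , notExcluded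
  where
  instance
    d≢0 : NonZero d
    d≢0 = nonTrivial⇒nonZero d
    q≢0 : NonZero q
    q≢0 = ℕ.m*n≢0⇒m≢0 q {p} {{nonTrivial⇒nonZero (q * p)}}
    c≢0 : NonZero (d ^ k * q)
    c≢0 = ℕ.m*n≢0 (d ^ k) q {{ℕ.m^n≢0 d k}}

  1≤c*y : 1 ≤ d ^ k * q * y
  1≤c*y = ℕ.*-mono-≤ (ℕ.>-nonZero⁻¹ (d ^ k * q)) 1≤y

  c*y<m : d ^ k * q * y < d ^ k * (q * p)
  c*y<m = subst (d ^ k * q * y <_) (ℕ.*-assoc (d ^ k) q p) (ℕ.*-monoʳ-< (d ^ k * q) y<p)

  notExcluded : ¬ (∃[ j ] 1 ≤ j × j ≤ k × + (d ^ k * q * y) ≡ + quotient d (q * p) k j)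
  -- The bound j ≥ 1 matters: `d ^ j` then unfolds to a multiple of `d`.
  notExcluded (j@(suc _) , _ , j≤k , eq) =
    d∤qp (∣-trans (∣-trans (m∣m*n _) (divides y (sym y*d^j≡p))) (divides q refl))
    where
    open ≡-Reasoning
    y*d^j≡p : y * d ^ j ≡ p
    y*d^j≡p = ℕ.*-cancelˡ-≡ _ _ (d ^ k * q) (begin
      d ^ k * q * (y * d ^ j)           ≡⟨ ℕ.*-assoc (d ^ k * q) y (d ^ j) ⟨
      d ^ k * q * y * d ^ j             ≡⟨ cong (_* d ^ j) (ℤ.+-injective eq) ⟩
      quotient d (q * p) k j * d ^ j    ≡⟨ m/n*n≡m {{ℕ.m^n≢0 d j}} (∣-trans (m^-mono-∣ d j≤k) (m∣m*n (q * p))) ⟩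
      d ^ k * (q * p)                   ≡⟨ ℕ.*-assoc (d ^ k) q p ⟨
      d ^ k * q * p ∎)

-- Powers of two with integer exponent, and the final bound

1/d≤1+N : ∀ d .{{_ : NonZero d}} N → + 1 / d ℚᵘ.≤ + suc N / 1
1/d≤1+N (suc d) N = ℚᵘ.*≤* (ℤ.+≤+ (s≤s z≤n))

-- For z ≥ 0 cancel 2^r. For z < 0 the left side is at most 1, and N ≥ 1 because 2^l is positive.
2^ᶻ-≤ : ∀ z {l r N} → z ℤ.+ + r ℤ.≤ + l → 2 ^ l ≤ 2 ^ r * N → 2^ᶻ z ℚᵘ.≤ + N / 1
2^ᶻ-≤ (+ a) {l} {r} {N} (ℤ.+≤+ a+r≤l) 2^l≤ =
  ℚᵘ.*≤* (ℤ.*-monoʳ-≤-nonNeg (+ 1) (ℤ.+≤+ (ℕ.*-cancelˡ-≤ (2 ^ r) {{ℕ.m^n≢0 2 r}} (begin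
    2 ^ r * 2 ^ a  ≡⟨ ℕ.^-distribˡ-+-* 2 r a ⟨
    2 ^ (r + a)    ≤⟨ ℕ.^-monoʳ-≤ 2 (subst (_≤ l) (ℕ.+-comm a r) a+r≤l) ⟩
    2 ^ l          ≤⟨ 2^l≤ ⟩
    2 ^ r * N ∎))))
  where open ℕ.≤-Reasoning
2^ᶻ-≤ -[1+ n ] {l} {r} {zero} _ 2^l≤ =
  contradiction (subst (2 ^ l ≤_) (ℕ.*-zeroʳ (2 ^ r)) 2^l≤) (ℕ.<⇒≱ (ℕ.m^n>0 2 l))
2^ᶻ-≤ -[1+ n ] {N = suc N} _ _ = 1/d≤1+N (2 ^ suc n) {{ℕ.m^n≢0 2 (suc n)}} N

l-D+1+r≤l : ∀ l {D r} → r < D → + l ℤ.- + D ℤ.+ + 1 ℤ.+ + r ℤ.≤ + l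
l-D+1+r≤l l {D} {r} r<D = begin
  + l ℤ.- + D ℤ.+ + 1 ℤ.+ + r      ≡⟨ rearrange (+ l) (+ D) (+ r) ⟩
  -- The strict bound r < D absorbs the summand 1.
  + l ℤ.+ (+ suc r ℤ.- + D)        ≤⟨ ℤ.+-monoʳ-≤ (+ l) (ℤ.i≤j⇒i-j≤0 (ℤ.+≤+ r<D)) ⟩
  + l ℤ.+ ℤ.0ℤ                     ≡⟨ ℤ.+-identityʳ (+ l) ⟩
  + l ∎
  where
  open ℤ.≤-Reasoning
  rearrange : ∀ l D r → l ℤ.- D ℤ.+ + 1 ℤ.+ r ≡ l ℤ.+ (+ 1 ℤ.+ r ℤ.- D)
  rearrange = solve-∀

theorem3p7 : ∀ {c ℓ} (d n k r : ℕ) .{{_ : NonTrivial d}} .{{_ : NonTrivial n}} → k ≥ 1 → r ≥ 1 →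
    (H : AbelianGroup c ℓ) (finite : IsFinite H) →
    (e : ℕ) → IsExponent H e → e ∣ d ^ k →
    gcd d n ≤ d ∸ 1 →
    d ^ k * n ≥ 6 →
    let G = H ⊕ Power (Cyclic (d ^ k * n)) r
        A = weightSet d n k
        0G = AbelianGroup.ε G in
    (D : ℕ) → IsDavenportConstant G A D →
    (l : ℕ) (S : Vector (AbelianGroup.Carrier G) l) →
    let N = numSubsets G A S 0G (weightedSum? H finite d n k r S 0G) in
    (+ N / 1) ℚᵘ.≥ 2^ᶻ (+ l ℤ.- + D ℤ.+ + 1)
theorem3p7 d n k r _ _ H finite e e-exp e∣d^k gcd≤ _ D D-davenport l S
  -- Matching on `divides-refl` replaces `n` by `q * p`, so that m = dᵏ(qp) and c = dᵏq.
  with p , p-prime , divides-refl q ← ∃-primeDivisor n =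
  2^ᶻ-≤ (+ l ℤ.- + D ℤ.+ + 1)
    (l-D+1+r≤l l (r<DavenportConstant H m r A (λ (1≤a , a<m , _) → 1≤a , a<m) D-davenport))
    (2^l≤2^r*#kernelSupports p-prime l r (proj₂ ∘ S) (weightedSum? H finite d n k r S _)
      (kernelSupport⇒zeroSum H m r A p-prime (d ^ k * q) (sym (ℕ.*-assoc (d ^ k) q p))
        -- The weights annihilate H since e ∣ dᵏ ∣ dᵏq ∣ dᵏqy.
        (λ y → multiple-exponent H e-exp (∣-trans e∣d^k (∣-trans (m∣m*n q) (m∣m*n y))))
        (weightSet-multiples d k q p (gcd<m⇒m∤n d n {{nonTrivial⇒nonZero d}} gcd≤)) S))
  where
  m = d ^ k * n
  A = weightSet d n k
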